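{- Let $X\in S_n$ avoid at least one permutation of length $k$ (i.e. $X\in\mathcal{C}_k$). Then the cost of \textsc{SGreedy} on $X$ is at most $n\,2^{O(k)}$; this holds with an arbitrary initial tree $T$.
   Context: $X$ contains $\pi\in S_k$ if some length-$k$ subsequence of $X$ is order-isomorphic to $\pi$; otherwise $X$ avoids $\pi$. Geometric model: $X=(x_1,\dots,x_n)$ is identified with access points $\{(x_t,t)\}$ (key, time). $\square_{pq}$ is the closed axis-parallel rectangle with corners $p,q$. An initial tree $T$ (BST on $[n]$ of depth $d$, root depth 1) is represented by the points $(x,s)$, $s=1-d,\dots,1-d(x)$, for each key $x$ of depth $d(x)$ (empty if there is no initial tree). For an algorithm producing output row by row, let $\tau(b,t)$ be the largest time $\le t$ at which column $b$ contains a point of $T$ or of the output so far. At time $t$ with access $(a,t)$, the stair $\mathrm{stair}_t(a)$ is the set of keys $b\ne a$ with $\tau(b,t-1)$ defined such that $\square_{(a,t),(b,\tau(b,t-1))}$ contains no point of $T\cup\{$output points at times $<t\}$ other than $(b,\tau(b,t-1))$. \textsc{GreedyLeft} adds $(a,t)$ and $(b,t)$ for $b\in\mathrm{stair}_t(a)$, $b<a$; \textsc{GreedyRight} adds $(a,t)$ and $(b,t)$ for $b\in\mathrm{stair}_t(a)$, $b>a$ (each computed with respect to its own output). \textsc{SGreedy} outputs the union of the \textsc{GreedyLeft} and \textsc{GreedyRight} outputs; its cost is the size of this union. -}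

module Defs where

open import Data.Nat as ℕ using (ℕ; zero; suc; _<_; _≤_; _⊔_; _∸_; _<ᵇ_)
open import Data.Integer as ℤ using (ℤ; +_; _≤ᵇ_)
open import Data.Integer.Properties as ℤP using ()
open import Data.Nat.Properties as ℕP using ()
open import Data.Bool using (Bool; true; false; not; _∨_; _∧_)
open import Data.List using (List; []; _∷_; _++_; map; filter; length; upTo; lookup; deduplicate; concatMap; filterᵇ)
open import Data.Bool.ListAction using (and)
open import Data.List.Relation.Binary.Sublist.Propositional using (_⊆_)
open import Data.Maybe using (Maybe; just; nothing)
open import Data.Product using (_×_; _,_; proj₁; proj₂; Σ; ∃-syntax)
open import Data.Product.Properties using (≡-dec)
open import Data.Fin using (Fin; cast)
open import Data.Unit using (⊤)
open import Relation.Nullary using (¬_; Dec)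
open import Relation.Nullary.Decidable using (⌊_⌋; ¬?)
open import Relation.Binary.PropositionalEquality using (_≡_)

range : ℕ → List ℕ
range n = map suc (upTo n)

-- A permutation in S_n, in one-line notation, is a list that is a
-- rearrangement of 1..n (we use _↭_ from the library in the statement).

OrderIso : List ℕ → List ℕ → Set
OrderIso xs ys =
  Σ (length xs ≡ length ys) λ eq → ∀ (i j : Fin (length xs)) →
    (lookup xs i < lookup xs j → lookup ys (cast eq i) < lookup ys (cast eq j)) ×
    (lookup ys (cast eq i) < lookup ys (cast eq j) → lookup xs i < lookup xs j)

Contains : List ℕ → List ℕ → Set
Contains X π = ∃[ ys ] (ys ⊆ X × OrderIso ys π)

Avoids : List ℕ → List ℕ → Set
Avoids X π = ¬ Contains X π

data Tree : Set where
  leaf : Tree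
  node : Tree → ℕ → Tree → Tree

inorder : Tree → List ℕ
inorder leaf = []
inorder (node l x r) = inorder l ++ (x ∷ inorder r)

IsBSTOn : ℕ → Tree → Set
IsBSTOn n T = inorder T ≡ range n

height : Tree → ℕ
height leaf = 0
height (node l x r) = suc (height l ⊔ height r)

keysWithDepth : ℕ → Tree → List (ℕ × ℕ)
keysWithDepth k leaf = []
keysWithDepth k (node l x r) =
  (x , k) ∷ (keysWithDepth (suc k) l ++ keysWithDepth (suc k) r)

-- Geometric points: (key , time)
Point : Set
Point = ℕ × ℤ

_≟P_ : (p q : Point) → Dec (p ≡ q)
_≟P_ = ≡-dec ℕ._≟_ ℤ._≟_

-- Points of an initial tree T of depth d: for each key x of depth d(x),
-- the points (x , s) for s = 1-d, …, 1-d(x).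
treePoints : Tree → List Point
treePoints T = concatMap col (keysWithDepth 1 T)
  where
  d = height T
  col : ℕ × ℕ → List Point
  col (x , dx) = map (λ i → (x , ((+ 1) ℤ.- (+ d)) ℤ.+ (+ i))) (upTo (suc (d ∸ dx)))

initPoints : Maybe Tree → List Point
initPoints nothing  = []
initPoints (just T) = treePoints T

ValidInit : ℕ → Maybe Tree → Set
ValidInit n nothing  = ⊤
ValidInit n (just T) = IsBSTOn n T

maxTime : List ℤ → Maybe ℤ
maxTime [] = nothing
maxTime (y ∷ ys) with maxTime ys
... | nothing = just y
... | just m  = just (y ℤ.⊔ m)

-- τ(b , t-1): latest time of a point in column b among the points P
-- (all points of P are at times < t).
tau : List Point → ℕ → Maybe ℤ
tau P b = maxTime (map proj₂ (filter (λ p → proj₁ p ℕ.≟ b) P))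

inBox : ℕ → ℤ → ℕ → ℤ → Point → Bool
inBox a t b s (x , y) =
  ((a ℕ.⊓ b) ℕ.≤ᵇ x) ∧ (x ℕ.≤ᵇ (a ⊔ b)) ∧ (s ≤ᵇ y) ∧ (y ≤ᵇ t)

boxEmpty : List Point → ℕ → ℤ → ℕ → ℤ → Bool
boxEmpty P a t b s = and (map (λ p → not (inBox a t b s p) ∨ ⌊ p ≟P (b , s) ⌋) P)

inStair : List Point → ℕ → ℤ → ℕ → Bool
inStair P a t b with tau P b
... | nothing = false
... | just s  = not ⌊ b ℕ.≟ a ⌋ ∧ boxEmpty P a t b s

Side : Set
Side = ℕ → ℕ → Bool

leftSide : Side
leftSide b a = b <ᵇ a

rightSide : Side
rightSide b a = a <ᵇ b

columns : List Point → List ℕ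
columns P = deduplicate ℕ._≟_ (map proj₁ P)

stair : Side → List Point → ℕ → ℤ → List ℕ
stair side P a t = filterᵇ (λ b → side b a ∧ inStair P a t b) (columns P)

-- run the one-sided greedy on accesses xs starting at time t, with
-- current point set P (initial tree ∪ output so far); returns the output points
runGreedy : Side → List Point → ℤ → List ℕ → List Point
runGreedy side P t [] = []
runGreedy side P t (a ∷ xs) =
  new ++ runGreedy side (new ++ P) (t ℤ.+ (+ 1)) xs
  where
  new = (a , t) ∷ map (λ b → (b , t)) (stair side P a t)

greedyLeft greedyRight : List ℕ → Maybe Tree → List Point
greedyLeft  X T = runGreedy leftSide  (initPoints T) (+ 1) X
greedyRight X T = runGreedy rightSide (initPoints T) (+ 1) X

sgreedyCost : List ℕ → Maybe Tree → ℕ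
sgreedyCost X T = length (deduplicate _≟P_ (greedyLeft X T ++ greedyRight X T))

{-# OPTIONS --safe #-}
-- If GreedyRight touches b at time t and later c > b at time s, then some access
-- falls into [b , c] × [t , s]: otherwise the access at time s is left of b, so c was
-- touched more recently than b, and one recurses to that earlier touch of c. Hence an
-- output containing the pattern in which every entry of π is replaced by an increasing
-- pair forces X to contain π; GreedyLeft is the mirror image.
--
-- It remains to bound linearly, with a factor 2^O(k), the ones of a matrix without a
-- 2k × 2k all-ones interval minor. This is Fox's refinement of the Marcus–Tardos
-- argument: cut the matrix into t × t blocks, call a block wide (tall) if it has at least
-- s non-empty columns (rows), bound the wide and tall blocks by halving, and recurse on
-- the contracted matrix, where each remaining block accounts for at most s² = t / 2 ones.
module Submission where

open import Defs
open import Data.Nat using (ℕ; _≤_; _*_; _^_)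
open import Data.List using (List)
open import Data.Maybe using (Maybe)
open import Data.Product using (_×_; ∃-syntax)
open import Data.List.Relation.Binary.Permutation.Propositional using (_↭_)

open import Data.Bool using (Bool; true; false; T; if_then_else_; not; _∧_; _∨_)
open import Data.Bool.ListAction using (and)
open import Data.Bool.Properties using (∨-zeroʳ; T-≡)
open import Data.Fin as Fin using (Fin; zero; suc; cast; toℕ)
open import Data.Fin.Properties using (toℕ<n)
open import Data.Integer as ℤ using (ℤ; +_; +≤+; +<+)
import Data.Integer.Properties as ℤ
open import Data.List using ([]; _∷_; _++_; deduplicate; filter; length; lookup; map; tabulate; upTo)
open import Data.List.Membership.DecPropositional _≟P_ using (_∈?_)
open import Data.List.Membership.Propositional using (_∈_; find)
open import Data.List.Membership.Propositional.Properties
open import Data.List.Properties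
  using (++-identityʳ; length-++; length-map; length-tabulate; length-upTo; map-tabulate)
open import Data.List.Relation.Binary.Permutation.Propositional using (↭-sym; ↭⇒↭ₛ)
open import Data.List.Relation.Binary.Permutation.Propositional.Properties
  using (∈-resp-↭; ↭-empty-inv; ↭-length)
open import Data.List.Relation.Binary.Sublist.Propositional using (_⊆_; _∷_; _∷ʳ_; minimum)
open import Data.List.Relation.Unary.All as All using (All; []; _∷_)
open import Data.List.Relation.Unary.All.Properties as All using (++⁺)
open import Data.List.Relation.Unary.AllPairs using (AllPairs; []; _∷_)
import Data.List.Relation.Unary.AllPairs.Properties as AllPairs
open import Data.List.Relation.Unary.Any using (here; there)
open import Data.List.Relation.Unary.Unique.DecPropositional.Properties using (deduplicate-!)
open import Data.List.Relation.Unary.Unique.Propositional using (Unique)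
import Data.List.Relation.Unary.Unique.Propositional.Properties as Unique
open import Data.Maybe using (just; nothing)
open import Data.Nat hiding (_/_)
open import Data.Nat.Divisibility using (divides-refl)
open import Data.Nat.DivMod using (_/_; +-distrib-/-∣ˡ; /-monoˡ-≤; m*n/n≡m; m<n⇒m/n≡0)
open import Data.Nat.Properties
open import Data.Nat.Tactic.RingSolver using (solve-∀)
open import Data.Product using (_,_; proj₁; proj₂)
open import Data.Sum using (_⊎_; inj₁; inj₂; map₁; map₂)
open import Function using (_∘_; case_of_; const; flip; Equivalence)
open import Relation.Binary.Definitions using (tri<; tri≈; tri>)
open import Relation.Binary.PropositionalEquality
open import Relation.Nullary using (contradiction; no; yes)
open import Relation.Nullary.Decidable using (⌊_⌋; dec-true; does)
open import Data.List.Relation.Binary.Permutation.Setoid.Properties (setoid ℕ) using (Unique-resp-↭)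

-- Finite sums

sumTo : ℕ → (ℕ → ℕ) → ℕ
sumTo zero    f = 0
sumTo (suc n) f = sumTo n f + f n

sumTo-mono : ∀ n {f g : ℕ → ℕ} → (∀ {i} → i < n → f i ≤ g i) → sumTo n f ≤ sumTo n g
sumTo-mono zero    f≤g = z≤n
sumTo-mono (suc n) f≤g = +-mono-≤ (sumTo-mono n (f≤g ∘ m<n⇒m<1+n)) (f≤g ≤-refl)

sumTo-cong : ∀ n {f g : ℕ → ℕ} → (∀ i → f i ≡ g i) → sumTo n f ≡ sumTo n g
sumTo-cong zero    f≡g = refl
sumTo-cong (suc n) f≡g = cong₂ _+_ (sumTo-cong n f≡g) (f≡g n)

sumTo-zero : ∀ n → sumTo n (const 0) ≡ 0
sumTo-zero zero    = refl
sumTo-zero (suc n) = trans (+-identityʳ _) (sumTo-zero n)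

sumTo-distrib-+ : ∀ n (f g : ℕ → ℕ) → sumTo n (λ i → f i + g i) ≡ sumTo n f + sumTo n g
sumTo-distrib-+ zero    f g = refl
sumTo-distrib-+ (suc n) f g rewrite sumTo-distrib-+ n f g =
  interchange (sumTo n f) (sumTo n g) (f n) (g n)
  where
  interchange : ∀ a b c d → a + b + (c + d) ≡ a + c + (b + d)
  interchange = solve-∀

sumTo-distribˡ-* : ∀ n c (f : ℕ → ℕ) → sumTo n (λ i → c * f i) ≡ c * sumTo n f
sumTo-distribˡ-* zero    c f = sym (*-zeroʳ c)
sumTo-distribˡ-* (suc n) c f rewrite sumTo-distribˡ-* n c f =
  sym (*-distribˡ-+ c (sumTo n f) (f n))

sumTo-swap : ∀ m n (f : ℕ → ℕ → ℕ) →
             sumTo m (λ i → sumTo n (f i)) ≡ sumTo n (λ j → sumTo m (flip f j))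
sumTo-swap zero    n f = sym (sumTo-zero n)
sumTo-swap (suc m) n f rewrite sumTo-swap m n f =
  sym (sumTo-distrib-+ n (λ j → sumTo m (flip f j)) (f m))

sumTo-+ : ∀ m n (f : ℕ → ℕ) → sumTo (m + n) f ≡ sumTo m f + sumTo n (λ j → f (m + j))
sumTo-+ m zero    f rewrite +-identityʳ m = sym (+-identityʳ _)
sumTo-+ m (suc n) f rewrite +-suc m n | sumTo-+ m n f = +-assoc (sumTo m f) _ _

sumTo-blocks : ∀ m t (f : ℕ → ℕ) →
               sumTo (m * t) f ≡ sumTo m (λ i → sumTo t (λ u → f (i * t + u)))
sumTo-blocks zero    t f = refl
sumTo-blocks (suc m) t f
  rewrite +-comm t (m * t) | sumTo-+ (m * t) t f | sumTo-blocks m t f = refl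

sumTo-product : ∀ m n (f g : ℕ → ℕ) →
                sumTo m (λ i → sumTo n (λ j → f i * g j)) ≡ sumTo m f * sumTo n g
sumTo-product m n f g = begin
  sumTo m (λ i → sumTo n (λ j → f i * g j)) ≡⟨ sumTo-cong m (λ i → sumTo-distribˡ-* n (f i) g) ⟩
  sumTo m (λ i → f i * sumTo n g)           ≡⟨ sumTo-cong m (λ i → *-comm (f i) (sumTo n g)) ⟩
  sumTo m (λ i → sumTo n g * f i)           ≡⟨ sumTo-distribˡ-* m (sumTo n g) f ⟩
  sumTo n g * sumTo m f                     ≡⟨ *-comm (sumTo n g) (sumTo m f) ⟩
  sumTo m f * sumTo n g                     ∎
  where open ≡-Reasoning

-- `A` will be the existence of a minor: one summand that yields it ends the count, and otherwise
-- every summand obeys its bound.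
sumTo-bound : ∀ {ℓ} {A : Set ℓ} n {f : ℕ → ℕ} {b} → (∀ i → A ⊎ f i ≤ b) → A ⊎ sumTo n f ≤ n * b
sumTo-bound zero    f≤b = inj₂ z≤n
sumTo-bound (suc n) {f} {b} f≤b with f≤b n | sumTo-bound n f≤b
... | inj₁ a  | _       = inj₁ a
... | inj₂ _  | inj₁ a  = inj₁ a
... | inj₂ le | inj₂ ih = inj₂ (≤-trans (+-mono-≤ ih le) (≤-reflexive (+-comm (n * b) b)))

-- Counting and bounded search

⟦_⟧ : Bool → ℕ
⟦ false ⟧ = 0
⟦ true ⟧  = 1

⟦⟧≤1 : ∀ b → ⟦ b ⟧ ≤ 1
⟦⟧≤1 false = z≤n
⟦⟧≤1 true  = ≤-refl

⟦⟧-≤ : ∀ b {m} → (b ≡ true → 1 ≤ m) → ⟦ b ⟧ ≤ m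
⟦⟧-≤ false _ = z≤n
⟦⟧-≤ true  f = f refl

count : ℕ → (ℕ → Bool) → ℕ
count n p = sumTo n (⟦_⟧ ∘ p)

count-≤ : ∀ n p → count n p ≤ n
count-≤ zero    p = z≤n
count-≤ (suc n) p = ≤-trans (+-mono-≤ (count-≤ n p) (⟦⟧≤1 (p n))) (≤-reflexive (+-comm n 1))

count-mono : ∀ p {m n} → m ≤ n → count m p ≤ count n p
count-mono p {m} m≤n with k , refl ← m≤n⇒∃[o]m+o≡n m≤n =
  subst (_ ≤_) (sym (sumTo-+ m k (⟦_⟧ ∘ p))) (m≤m+n _ _)

-- Makes `λ y → count y p` usable as a monotone labelling: every label below the total is attained
-- at an index where `p` holds.
count-nth : ∀ n p {i} → i < count n p → ∃[ y ] (y < n × count y p ≡ i × p y ≡ true)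
count-nth (suc n) p {i} i<c with i <? count n p
... | yes i<c′ = let y , y<n , eqs = count-nth n p i<c′ in y , m<n⇒m<1+n y<n , eqs
... | no  i≮c′ with p n in eq
... | false = contradiction (subst (i <_) (+-identityʳ _) i<c) i≮c′
... | true  = n , ≤-refl , ≤-antisym (≮⇒≥ i≮c′) (s≤s⁻¹ (subst (i <_) (+-comm _ 1) i<c)) , eq

count-witness : ∀ n p → 1 ≤ count n p → ∃[ y ] (y < n × p y ≡ true)
count-witness n p 1≤c = let y , y<n , _ , py = count-nth n p 1≤c in y , y<n , py

anyTo : ℕ → (ℕ → Bool) → Bool
anyTo zero    p = false
anyTo (suc n) p = anyTo n p ∨ p n

anyTo⁻ : ∀ n p → anyTo n p ≡ true → ∃[ i ] (i < n × p i ≡ true)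
anyTo⁻ (suc n) p any with anyTo n p in eq
... | true  = let i , i<n , pi = anyTo⁻ n p eq in i , m<n⇒m<1+n i<n , pi
... | false = n , ≤-refl , any

anyTo⁺ : ∀ n p {i} → i < n → p i ≡ true → anyTo n p ≡ true
anyTo⁺ (suc n) p {i} i<1+n pi with i ≟ n
... | yes refl = trans (cong (anyTo n p ∨_) pi) (∨-zeroʳ _)
... | no  i≢n  rewrite anyTo⁺ n p (≤∧≢⇒< (s≤s⁻¹ i<1+n) i≢n) pi = refl

∧-true⁻ : ∀ {a b} → a ∧ b ≡ true → a ≡ true × b ≡ true
∧-true⁻ {true} {true} _ = refl , refl

≤ᵇ-true⁻ : ∀ m n → (m ≤ᵇ n) ≡ true → m ≤ n
≤ᵇ-true⁻ m n eq = ≤ᵇ⇒≤ m n (subst T (sym eq) _)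

≤ᵇ-true⁺ : ∀ {m n} → m ≤ n → (m ≤ᵇ n) ≡ true
≤ᵇ-true⁺ {m} {n} m≤n with m ≤ᵇ n | ≤⇒≤ᵇ m≤n
... | true | _ = refl

-- Interval minors

-- An interval minor of P equal to the k × l all-ones matrix: the fibres of the
-- monotone labellings are the intervals of rows and columns being contracted.
-- The first argument of P is the column.
record Minor (P : ℕ → ℕ → Set) (k l : ℕ) : Set where
  field
    rowLabel colLabel : ℕ → ℕ
    rowLabel-mono     : ∀ {y y′} → y ≤ y′ → rowLabel y ≤ rowLabel y′
    colLabel-mono     : ∀ {x x′} → x ≤ x′ → colLabel x ≤ colLabel x′
    entry             : ∀ {i j} → i < k → j < l →
                        ∃[ x ] ∃[ y ] (colLabel x ≡ j × rowLabel y ≡ i × P x y)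

module _ {P P′ : ℕ → ℕ → Set} {k l : ℕ} where

  -- Labels are composed with `f` and `g`. When these divide by a block length, a minor of a
  -- contracted matrix becomes one of the original.
  minor-pullback : (f g : ℕ → ℕ) →
                   (∀ {x x′} → x ≤ x′ → f x ≤ f x′) → (∀ {y y′} → y ≤ y′ → g y ≤ g y′) →
                   (∀ {x y} → P x y → ∃[ x′ ] ∃[ y′ ] (f x′ ≡ x × g y′ ≡ y × P′ x′ y′)) →
                   Minor P k l → Minor P′ k l
  minor-pullback f g f-mono g-mono lift m = record
    { rowLabel      = rowLabel ∘ g
    ; colLabel      = colLabel ∘ f
    ; rowLabel-mono = rowLabel-mono ∘ g-mono
    ; colLabel-mono = colLabel-mono ∘ f-mono
    ; entry         = λ i<k j<l → let x , y , x∈j , y∈i , Pxy = entry i<k j<l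
                                      x′ , y′ , fx′ , gy′ , P′x′y′ = lift Pxy
                                  in x′ , y′ , trans (cong colLabel fx′) x∈j
                                   , trans (cong rowLabel gy′) y∈i , P′x′y′
    }
    where open Minor m

  minor-map : (∀ {x y} → P x y → P′ x y) → Minor P k l → Minor P′ k l
  minor-map P⇒P′ = minor-pullback (λ x → x) (λ y → y) (λ le → le) (λ le → le)
                                  (λ Pxy → _ , _ , refl , refl , P⇒P′ Pxy)

minor-transpose : ∀ {P k l} → Minor P k l → Minor (flip P) l k
minor-transpose m = record
  { rowLabel      = colLabel
  ; colLabel      = rowLabel
  ; rowLabel-mono = colLabel-mono
  ; colLabel-mono = rowLabel-mono
  ; entry         = λ i<l j<k → let x , y , x∈i , y∈j , Pxy = entry j<k i<l
                                in y , x , y∈j , x∈i , Pxy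
  }
  where open Minor m

module _ {P P′ : ℕ → ℕ → Set} {k l : ℕ} (mid : ℕ) (P⇒P′ : ∀ {x y} → P x y → P′ x y) where

  -- All columns from `mid` on are contracted into a new last column. It meets every row interval
  -- because each row with an entry of `P` also has an entry of `P′` there.
  minor-addRight : (∀ {x y} → P x y → x < mid) →
                   (∀ {x y} → P x y → ∃[ x′ ] (mid ≤ x′ × P′ x′ y)) →
                   Minor P k (suc l) → Minor P′ k (2+ l)
  minor-addRight left extend m = record
    { rowLabel      = rowLabel
    ; colLabel      = lab
    ; rowLabel-mono = rowLabel-mono
    ; colLabel-mono = lab-mono
    ; entry         = ent
    }
    where
    open Minor m
    lab : ℕ → ℕ
    lab x with x <? mid
    -- Labels of the old minor may be arbitrarily large left of `mid`; the cap keeps them at most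
    -- the constant label on the right.
    ... | yes _ = colLabel x ⊓ suc l
    ... | no  _ = suc l
    lab-mono : ∀ {x x′} → x ≤ x′ → lab x ≤ lab x′
    lab-mono {x} {x′} x≤x′ with x <? mid | x′ <? mid
    ... | yes _    | yes _  = ⊓-monoˡ-≤ (suc l) (colLabel-mono x≤x′)
    ... | yes _    | no  _  = m⊓n≤n (colLabel x) (suc l)
    ... | no  _    | no  _  = ≤-refl
    ... | no  x≮m  | yes x′<m = contradiction (≤-<-trans x≤x′ x′<m) x≮m
    lab-left : ∀ {x} → x < mid → lab x ≡ colLabel x ⊓ suc l
    lab-left {x} x<m with x <? mid
    ... | yes _   = refl
    ... | no  x≮m = contradiction x<m x≮m
    lab-right : ∀ {x} → mid ≤ x → lab x ≡ suc l
    lab-right {x} m≤x with x <? mid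
    ... | yes x<m = contradiction m≤x (<⇒≱ x<m)
    ... | no  _   = refl
    ent : ∀ {i j} → i < k → j < 2+ l → ∃[ x ] ∃[ y ] (lab x ≡ j × rowLabel y ≡ i × P′ x y)
    ent {j = j} i<k j<2+l with j <? suc l
    ... | yes j<1+l =
      let x , y , x∈j , y∈i , Pxy = entry i<k j<1+l
          x∈j′ = trans (lab-left (left Pxy))
                       (trans (cong (_⊓ suc l) x∈j) (m≤n⇒m⊓n≡m (<⇒≤ j<1+l)))
      in x , y , x∈j′ , y∈i , P⇒P′ Pxy
    ... | no j≮1+l =
      -- The old minor has a column 0, whose entry in row interval `i` supplies the row to extend.
      let x , y , _ , y∈i , Pxy = entry i<k z<s
          x′ , m≤x′ , P′x′y = extend Pxy
          j≡ = ≤-antisym (≮⇒≥ j≮1+l) (s≤s⁻¹ j<2+l)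
      in x′ , y , trans (lab-right m≤x′) j≡ , y∈i , P′x′y

  -- Shifting the old labels by one frees label 0 for the columns before `mid`.
  minor-addLeft : (∀ {x y} → P x y → mid ≤ x) →
                  (∀ {x y} → P x y → ∃[ x′ ] (x′ < mid × P′ x′ y)) →
                  Minor P k (suc l) → Minor P′ k (2+ l)
  minor-addLeft right extend m = record
    { rowLabel      = rowLabel
    ; colLabel      = lab
    ; rowLabel-mono = rowLabel-mono
    ; colLabel-mono = lab-mono
    ; entry         = ent
    }
    where
    open Minor m
    lab : ℕ → ℕ
    lab x with x <? mid
    ... | yes _ = 0
    ... | no  _ = suc (colLabel x)
    lab-mono : ∀ {x x′} → x ≤ x′ → lab x ≤ lab x′
    lab-mono {x} {x′} x≤x′ with x <? mid | x′ <? mid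
    ... | yes _   | _        = z≤n
    ... | no  _   | no  _    = s≤s (colLabel-mono x≤x′)
    ... | no  x≮m | yes x′<m = contradiction (≤-<-trans x≤x′ x′<m) x≮m
    lab-left : ∀ {x} → x < mid → lab x ≡ 0
    lab-left {x} x<m with x <? mid
    ... | yes _   = refl
    ... | no  x≮m = contradiction x<m x≮m
    lab-right : ∀ {x} → mid ≤ x → lab x ≡ suc (colLabel x)
    lab-right {x} m≤x with x <? mid
    ... | yes x<m = contradiction m≤x (<⇒≱ x<m)
    ... | no  _   = refl
    ent : ∀ {i j} → i < k → j < 2+ l → ∃[ x ] ∃[ y ] (lab x ≡ j × rowLabel y ≡ i × P′ x y)
    ent {j = zero} i<k _ =
      let x , y , _ , y∈i , Pxy = entry i<k z<s
          x′ , x′<m , P′x′y = extend Pxy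
      in x′ , y , lab-left x′<m , y∈i , P′x′y
    ent {j = suc j} i<k (s≤s j<1+l) =
      let x , y , x∈j , y∈i , Pxy = entry i<k j<1+l
      in x , y , trans (lab-right (right Pxy)) (cong suc x∈j) , y∈i , P⇒P′ Pxy

Matrix : Set
Matrix = ℕ → ℕ → Bool

Support : Matrix → ℕ → ℕ → Set
Support M x y = M x y ≡ true

-- Rows with many ones

double : ∀ m → m + (m + 0) ≡ m + m
double = solve-∀

quadruple : ∀ k m → k * (m + (m + (m + (m + 0)))) ≡ k * m + k * m + (k * m + k * m)
quadruple = solve-∀

module _ (k N : ℕ) (M : Matrix) where

  rowOnes : ℕ → ℕ → ℕ → ℕ
  rowOnes c t y = count t (λ u → M (c + u) y)

  Strip : ℕ → ℕ → (ℕ → Bool) → ℕ → ℕ → Set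
  Strip c t Q x y = c ≤ x × x < c + t × M x y ≡ true × Q y ≡ true

  rowOnes-witness : ∀ c t y → 1 ≤ rowOnes c t y →
                    ∃[ x ] (c ≤ x × x < c + t × M x y ≡ true)
  rowOnes-witness c t y 1≤r =
    let u , u<t , Mxy = count-witness t (λ u → M (c + u) y) 1≤r
    in c + u , m≤m+n c u , +-monoʳ-< c u<t , Mxy

  -- Contracting the whole strip to one column leaves a one in each selected row, and `count y Q`
  -- gives these rows distinct labels.
  minor-singleColumn : ∀ c t (Q : ℕ → Bool) → (∀ y → Q y ≡ true → 1 ≤ rowOnes c t y) →
                       k ≤ count N Q → Minor (Strip c t Q) k 1
  minor-singleColumn c t Q dense k≤Q = record
    { rowLabel      = λ y → count y Q
    ; colLabel      = const 0
    ; rowLabel-mono = count-mono Q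
    ; colLabel-mono = λ _ → z≤n
    ; entry         = λ { i<k z<s →
        let y , _ , y∈i , Qy = count-nth N Q (<-≤-trans i<k k≤Q)
            x , c≤x , x<c+t , Mxy = rowOnes-witness c t y (dense y Qy)
        in x , y , refl , y∈i , c≤x , x<c+t , Mxy , Qy }
    }

  module _ (c h s : ℕ) (Q : ℕ → Bool) where

    left right : ℕ → ℕ
    left  = rowOnes c h
    right = rowOnes (c + h) h

    leftHeavy rightHeavy leftSpread rightSpread : ℕ → Bool
    leftHeavy   y = Q y ∧ (s + s ≤ᵇ left y)
    rightHeavy  y = Q y ∧ (s + s ≤ᵇ right y)
    leftSpread  y = Q y ∧ (s ≤ᵇ left y) ∧ (1 ≤ᵇ right y)
    rightSpread y = Q y ∧ (s ≤ᵇ right y) ∧ (1 ≤ᵇ left y)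

    rowOnes-halves : ∀ y → rowOnes c (h + h) y ≡ left y + right y
    rowOnes-halves y = trans (sumTo-+ h h (λ u → ⟦ M (c + u) y ⟧))
      (cong (_+_ (left y)) (sumTo-cong h (λ u → cong (λ x → ⟦ M x y ⟧) (sym (+-assoc c h u)))))

    -- If one half is empty, the other holds all `s + s` ones (heavy). If neither is, one half holds
    -- at least `s` by pigeonhole and the other at least one (spread).
    classify : (∀ y → Q y ≡ true → s + s ≤ rowOnes c (h + h) y) → ∀ y →
               ⟦ Q y ⟧ ≤ ⟦ leftHeavy y ⟧ + ⟦ rightHeavy y ⟧ + (⟦ leftSpread y ⟧ + ⟦ rightSpread y ⟧)
    classify dense y with Q y in eq
    ... | false = z≤n
    ... | true  with s + s ≤? left y | s + s ≤? right y
    ... | yes p | _     rewrite ≤ᵇ-true⁺ p = s≤s z≤n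
    ... | no _  | yes p rewrite ≤ᵇ-true⁺ p = ≤-trans (m≤n+m 1 ⟦ s + s ≤ᵇ left y ⟧) (m≤m+n (⟦ s + s ≤ᵇ left y ⟧ + 1) _)
    ... | no ¬p | no ¬q = ≤-trans spread (m≤n+m _ (⟦ s + s ≤ᵇ left y ⟧ + ⟦ s + s ≤ᵇ right y ⟧))
      where
      total : s + s ≤ left y + right y
      total = subst (s + s ≤_) (rowOnes-halves y) (dense y eq)
      left≥1 : 1 ≤ left y
      left≥1 = n≢0⇒n>0 λ eq → ¬q (subst (λ r → s + s ≤ r + right y) eq total)
      right≥1 : 1 ≤ right y
      right≥1 = n≢0⇒n>0 λ eq →
        ¬p (subst (s + s ≤_) (+-identityʳ _) (subst (λ r → s + s ≤ left y + r) eq total))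
      spread : 1 ≤ ⟦ (s ≤ᵇ left y) ∧ (1 ≤ᵇ right y) ⟧ + ⟦ (s ≤ᵇ right y) ∧ (1 ≤ᵇ left y) ⟧
      spread with s ≤? left y | s ≤? right y
      ... | yes p | _     rewrite ≤ᵇ-true⁺ p | ≤ᵇ-true⁺ right≥1 = s≤s z≤n
      ... | no _  | yes p rewrite ≤ᵇ-true⁺ p | ≤ᵇ-true⁺ left≥1 = m≤n+m 1 _
      ... | no p  | no q  = contradiction total (<⇒≱ (+-mono-< (≰⇒> p) (≰⇒> q)))

    count-classify : (∀ y → Q y ≡ true → s + s ≤ rowOnes c (h + h) y) →
      count N Q ≤ count N leftHeavy + count N rightHeavy + (count N leftSpread + count N rightSpread)
    count-classify dense = ≤-trans (sumTo-mono N (λ {y} _ → classify dense y)) (≤-reflexive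
      (trans (sumTo-distrib-+ N _ _) (cong₂ _+_ (sumTo-distrib-+ N _ _) (sumTo-distrib-+ N _ _))))

    left⇒whole : ∀ {Q′ x y} → (∀ {y} → Q′ y ≡ true → Q y ≡ true) →
                 Strip c h Q′ x y → Strip c (h + h) Q x y
    left⇒whole Q′⇒Q (c≤x , x< , Mxy , Q′y) =
      c≤x , <-≤-trans x< (+-monoʳ-≤ c (m≤m+n h h)) , Mxy , Q′⇒Q Q′y

    right⇒whole : ∀ {Q′ x y} → (∀ {y} → Q′ y ≡ true → Q y ≡ true) →
                  Strip (c + h) h Q′ x y → Strip c (h + h) Q x y
    right⇒whole {x = x} Q′⇒Q (c+h≤x , x< , Mxy , Q′y) =
      ≤-trans (m≤m+n c h) c+h≤x , subst (x <_) (+-assoc c h h) x< , Mxy , Q′⇒Q Q′y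

    module _ {l b : ℕ} (dense : ∀ y → Q y ≡ true → s + s ≤ rowOnes c (h + h) y) where

      -- A minor among heavy rows already has full width. One among spread rows is a column short;
      -- the opposite half, non-empty in each of these rows, is contracted to supply it.
      halve : Minor (Strip c h leftHeavy) k (2+ l) ⊎ count N leftHeavy ≤ b →
              Minor (Strip (c + h) h rightHeavy) k (2+ l) ⊎ count N rightHeavy ≤ b →
              Minor (Strip c h leftSpread) k (suc l) ⊎ count N leftSpread ≤ b →
              Minor (Strip (c + h) h rightSpread) k (suc l) ⊎ count N rightSpread ≤ b →
              Minor (Strip c (h + h) Q) k (2+ l) ⊎ count N Q ≤ b + b + (b + b)
      halve (inj₁ m) _ _ _ = inj₁ (minor-map (left⇒whole {leftHeavy} (proj₁ ∘ ∧-true⁻)) m)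
      halve _ (inj₁ m) _ _ = inj₁ (minor-map (right⇒whole {rightHeavy} (proj₁ ∘ ∧-true⁻)) m)
      halve _ _ (inj₁ m) _ = inj₁ (minor-addRight (c + h)
        (left⇒whole {leftSpread} (proj₁ ∘ ∧-true⁻)) (proj₁ ∘ proj₂)
        (λ {_} {y} (_ , _ , _ , Q′y) →
          let Qy , both = ∧-true⁻ Q′y
              x′ , le , lt , Mx′y = rowOnes-witness (c + h) h y (≤ᵇ-true⁻ 1 _ (proj₂ (∧-true⁻ {s ≤ᵇ left y} both)))
          in x′ , le , right⇒whole {Q} (λ e → e) (le , lt , Mx′y , Qy))
        m)
      halve _ _ _ (inj₁ m) = inj₁ (minor-addLeft (c + h)
        (right⇒whole {rightSpread} (proj₁ ∘ ∧-true⁻)) proj₁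
        (λ {_} {y} (_ , _ , _ , Q′y) →
          let Qy , both = ∧-true⁻ Q′y
              x′ , le , lt , Mx′y = rowOnes-witness c h y (≤ᵇ-true⁻ 1 _ (proj₂ (∧-true⁻ {s ≤ᵇ right y} both)))
          in x′ , lt , left⇒whole {Q} (λ e → e) (le , lt , Mx′y , Qy))
        m)
      halve (inj₂ p) (inj₂ q) (inj₂ r) (inj₂ t) =
        inj₂ (≤-trans (count-classify dense) (+-mono-≤ (+-mono-≤ p q) (+-mono-≤ r t)))

  -- Halving the columns: a row keeps all its required ones in one half, or keeps
  -- half of them there while the other half is non-empty and can be contracted to
  -- one more column of the minor. The density 2^l and the bound k 4^a are
  -- preserved by this recursion.
  denseRows : ∀ a l c (Q : ℕ → Bool) → (∀ y → Q y ≡ true → 2 ^ l ≤ rowOnes c (2 ^ a) y) →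
              Minor (Strip c (2 ^ a) Q) k (suc l) ⊎ count N Q ≤ k * 4 ^ a
  denseRows a zero c Q dense with k ≤? count N Q
  ... | yes k≤Q = inj₁ (minor-singleColumn c (2 ^ a) Q dense k≤Q)
  ... | no  k≰Q = inj₂ (≤-trans (<⇒≤ (≰⇒> k≰Q)) (m≤m*n k (4 ^ a) {{m^n≢0 4 a}}))
  -- A single column cannot hold the required `2 ^ suc l ≥ 2` ones, so no row is selected.
  denseRows zero (suc l) c Q dense with 1 ≤? count N Q
  ... | yes 1≤Q = let y , _ , Qy = count-witness N Q 1≤Q
                  in contradiction (≤-trans (dense y Qy) (count-≤ 1 (λ u → M (c + u) y)))
                                   (<⇒≱ (*-monoʳ-≤ 2 (m^n>0 2 l)))
  ... | no  1≰Q = inj₂ (≤-trans (s≤s⁻¹ (≰⇒> 1≰Q)) z≤n)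
  denseRows (suc a) (suc l) c Q dense
    rewrite double (2 ^ a) | double (2 ^ l) | quadruple k (4 ^ a) =
    -- Each of the four classes pays `k * 4 ^ a`, a quarter of `k * 4 ^ suc a`.
    halve c h s Q dense
      (denseRows a (suc l) c       _ λ y → heavy  {Q y})
      (denseRows a (suc l) (c + h) _ λ y → heavy  {Q y})
      (denseRows a l       c       _ λ y → spread {Q y})
      (denseRows a l       (c + h) _ λ y → spread {Q y})
    where
    h = 2 ^ a
    s = 2 ^ l
    heavy : ∀ {q m} → q ∧ (s + s ≤ᵇ m) ≡ true → 2 ^ suc l ≤ m
    heavy {q} e = ≤-trans (≤-reflexive (double s)) (≤ᵇ-true⁻ _ _ (proj₂ (∧-true⁻ {q} e)))
    spread : ∀ {q m r} → q ∧ (s ≤ᵇ m) ∧ r ≡ true → s ≤ m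
    spread {q} e = ≤ᵇ-true⁻ _ _ (proj₁ (∧-true⁻ (proj₂ (∧-true⁻ {q} e))))

-- Contraction into blocks

ones : ℕ → ℕ → Matrix → ℕ
ones m n M = sumTo m (λ x → count n (M x))

module _ (t : ℕ) .{{_ : NonZero t}} where

  [i*t+u]/t≡i : ∀ i {u} → u < t → (i * t + u) / t ≡ i
  [i*t+u]/t≡i i {u} u<t = begin
    (i * t + u) / t   ≡⟨ +-distrib-/-∣ˡ u (divides-refl i) ⟩
    i * t / t + u / t ≡⟨ cong₂ _+_ (m*n/n≡m i t) (m<n⇒m/n≡0 u<t) ⟩
    i + 0             ≡⟨ +-identityʳ i ⟩
    i                 ∎
    where open ≡-Reasoning

  contractRows contractCols contract : Matrix → Matrix
  contractRows M x Y = anyTo t (λ v → M x (Y * t + v))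
  contractCols M X y = anyTo t (λ u → M (X * t + u) y)
  contract           = contractCols ∘ contractRows

  contractRows-minor : ∀ {M k l} → Minor (Support (contractRows M)) k l → Minor (Support M) k l
  contractRows-minor {M} = minor-pullback (λ x → x) (_/ t) (λ le → le) (/-monoˡ-≤ t)
    λ {x} {Y} any → let v , v<t , Mxy = anyTo⁻ t (λ v → M x (Y * t + v)) any
                    in x , Y * t + v , refl , [i*t+u]/t≡i Y v<t , Mxy

  contractCols-minor : ∀ {M k l} → Minor (Support (contractCols M)) k l → Minor (Support M) k l
  contractCols-minor {M} = minor-pullback (_/ t) (λ y → y) (/-monoˡ-≤ t) (λ le → le)
    λ {X} {y} any → let u , u<t , Mxy = anyTo⁻ t (λ u → M (X * t + u) y) any
                    in X * t + u , y , [i*t+u]/t≡i X u<t , refl , Mxy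

  module _ (M : Matrix) where

    blockOnes nonemptyCols nonemptyRows : ℕ → ℕ → ℕ
    blockOnes    X Y = ones t t (λ u v → M (X * t + u) (Y * t + v))
    nonemptyCols X Y = count t (λ u → contractRows M (X * t + u) Y)
    nonemptyRows X Y = count t (λ v → contractCols M X (Y * t + v))

    ones-blocks : ∀ m n → ones (m * t) (n * t) M ≡ sumTo m (λ X → sumTo n (blockOnes X))
    ones-blocks m n = trans (sumTo-blocks m t _) (sumTo-cong m λ X →
      trans (sumTo-cong t (λ u → sumTo-blocks n t _)) (sumTo-swap t n _))

    -- A one at `(u , v)` makes both column `u` and row `v` of the block non-empty, so its indicator
    -- is at most a product of two indicators, and the double sum of these products factors.
    blockOnes≤cols*rows : ∀ X Y → blockOnes X Y ≤ nonemptyCols X Y * nonemptyRows X Y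
    blockOnes≤cols*rows X Y = ≤-trans
      (sumTo-mono t λ {u} u<t → sumTo-mono t λ {v} v<t → ⟦⟧-≤ (M (X * t + u) (Y * t + v)) λ Mxy →
        ≤-reflexive (sym (cong₂ (λ b b′ → ⟦ b ⟧ * ⟦ b′ ⟧)
          (anyTo⁺ t (λ v → M (X * t + u) (Y * t + v)) v<t Mxy)
          (anyTo⁺ t (λ u → M (X * t + u) (Y * t + v)) u<t Mxy))))
      (≤-reflexive (sumTo-product t t _ _))

    blockOnes≤t² : ∀ X Y → blockOnes X Y ≤ t * t * 1
    blockOnes≤t² X Y = ≤-trans (blockOnes≤cols*rows X Y)
      (≤-trans (*-mono-≤ (count-≤ t _) (count-≤ t _)) (≤-reflexive (sym (*-identityʳ (t * t)))))

    nonemptyCols-contract : ∀ X Y → 1 ≤ nonemptyCols X Y → contract M X Y ≡ true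
    nonemptyCols-contract X Y 1≤c =
      let u , u<t , any = count-witness t (λ u → contractRows M (X * t + u) Y) 1≤c
      in anyTo⁺ t (λ u → contractRows M (X * t + u) Y) u<t any

    module _ (s : ℕ) where

      wide tall : ℕ → ℕ → Bool
      wide X Y = s ≤ᵇ nonemptyCols X Y
      tall X Y = s ≤ᵇ nonemptyRows X Y

      -- Wide and tall blocks are charged their full area. Any other block has fewer than `s`
      -- non-empty columns and rows, and its `s * s` is charged to its entry in the contraction.
      blockOnes-bound : ∀ X Y → blockOnes X Y ≤
        t * t * ⟦ wide X Y ⟧ + t * t * ⟦ tall X Y ⟧ + s * s * ⟦ contract M X Y ⟧
      blockOnes-bound X Y
        with s ≤? nonemptyCols X Y | s ≤? nonemptyRows X Y | 1 ≤? nonemptyCols X Y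
      ... | yes p | _ | _ rewrite ≤ᵇ-true⁺ p =
        ≤-trans (blockOnes≤t² X Y) (≤-trans (m≤m+n (t * t * 1) _) (m≤m+n _ _))
      ... | no _ | yes p | _ rewrite ≤ᵇ-true⁺ p =
        ≤-trans (blockOnes≤t² X Y)
          (≤-trans (m≤n+m (t * t * 1) (t * t * ⟦ wide X Y ⟧)) (m≤m+n _ _))
      ... | no p | no q | yes r rewrite nonemptyCols-contract X Y r = begin
        blockOnes X Y                       ≤⟨ blockOnes≤cols*rows X Y ⟩
        nonemptyCols X Y * nonemptyRows X Y ≤⟨ *-mono-≤ (<⇒≤ (≰⇒> p)) (<⇒≤ (≰⇒> q)) ⟩
        s * s                               ≡⟨ *-identityʳ (s * s) ⟨
        s * s * 1                           ≤⟨ m≤n+m (s * s * 1) _ ⟩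
        t * t * ⟦ wide X Y ⟧ + t * t * ⟦ tall X Y ⟧ + s * s * 1 ∎
        where open ≤-Reasoning
      -- Without a non-empty column the block contains no ones.
      ... | no _ | no _ | no r =
        ≤-trans (blockOnes≤cols*rows X Y)
          (≤-trans (*-monoˡ-≤ (nonemptyRows X Y) (s≤s⁻¹ (≰⇒> r))) z≤n)

      ones-bound : ∀ n → ones (n * t) (n * t) M ≤
        t * t * ones n n wide + t * t * ones n n tall + s * s * ones n n (contract M)
      ones-bound n = ≤-trans (≤-reflexive (ones-blocks n n)) (≤-trans
        (sumTo-mono n λ {X} _ → sumTo-mono n λ {Y} _ → blockOnes-bound X Y) (≤-reflexive linear))
        where
        scale : ∀ c A → sumTo n (λ X → sumTo n (λ Y → c * ⟦ A X Y ⟧)) ≡ c * ones n n A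
        scale c A = trans (sumTo-cong n λ X → sumTo-distribˡ-* n c (⟦_⟧ ∘ A X))
                          (sumTo-distribˡ-* n c (λ X → count n (A X)))
        linear₂ : ∀ (f g : ℕ → ℕ → ℕ) →
                  sumTo n (λ X → sumTo n (λ Y → f X Y + g X Y)) ≡
                  sumTo n (λ X → sumTo n (f X)) + sumTo n (λ X → sumTo n (g X))
        linear₂ f g = trans (sumTo-cong n λ X → sumTo-distrib-+ n (f X) (g X))
                            (sumTo-distrib-+ n _ _)
        linear : sumTo n (λ X → sumTo n (λ Y →
                   t * t * ⟦ wide X Y ⟧ + t * t * ⟦ tall X Y ⟧ + s * s * ⟦ contract M X Y ⟧)) ≡
                 t * t * ones n n wide + t * t * ones n n tall + s * s * ones n n (contract M)
        linear = trans (linear₂ _ _) (cong₂ _+_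
                   (trans (linear₂ _ _) (cong₂ _+_ (scale (t * t) wide) (scale (t * t) tall)))
                   (scale (s * s) (contract M)))

-- Linear bound on the ones of a matrix without a square all-ones minor.

module Fox (l : ℕ) where

  -- Halving turns `2 ^ l` ones per row into `suc l` columns, which fixes `s` and `k`; the exponent
  -- `a` is chosen so that `t` is a power of two equal to `2 s²`.
  k s a t : ℕ
  k = suc l
  s = 2 ^ l
  a = suc (l + l)
  t = 2 ^ a

  instance
    t≢0 : NonZero t
    t≢0 = m^n≢0 2 a

  2≤t : 2 ≤ t
  2≤t = *-monoʳ-≤ 2 (m^n>0 2 (l + l))

  -- Chosen so that the wide and the tall blocks together cost exactly `density` per strip.
  density : ℕ
  density = 2 * (k * 4 ^ a * (t * t))

  t≡2s² : t ≡ s * s + s * s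
  t≡2s² = trans (double (2 ^ (l + l))) (cong₂ _+_ (^-distribˡ-+-* 2 l l) (^-distribˡ-+-* 2 l l))

  density≥1 : 1 ≤ density
  density≥1 = *-mono-≤ {1} {2} (s≤s z≤n)
    (*-mono-≤ (*-mono-≤ {1} {k} (s≤s z≤n) (m^n>0 4 a)) (*-mono-≤ (m^n>0 2 a) (m^n>0 2 a)))

  -- In a strip of `t` columns, once rows are contracted, the wide blocks are the rows with at least
  -- `s` ones. `denseRows` bounds their number independently of `n`, and there are `n` strips.
  wide-bound : ∀ n M → Minor (Support M) k k ⊎ ones n n (wide t M s) ≤ n * (k * 4 ^ a)
  wide-bound n M = sumTo-bound n λ X → map₁
    (contractRows-minor t ∘ minor-map (proj₁ ∘ proj₂ ∘ proj₂))
    (denseRows k n (contractRows t M) a l (X * t) (wide t M s X) λ Y → ≤ᵇ-true⁻ _ _)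

  tall-bound : ∀ n M → Minor (Support M) k k ⊎ ones n n (tall t M s) ≤ n * (k * 4 ^ a)
  tall-bound n M = map₂ (≤-trans (≤-reflexive (sumTo-swap n n _))) (sumTo-bound n λ Y → map₁
    (contractCols-minor t ∘ minor-transpose ∘ minor-map (proj₁ ∘ proj₂ ∘ proj₂))
    (denseRows k n (flip (contractCols t M)) a l (Y * t) (flip (tall t M s) Y) λ X → ≤ᵇ-true⁻ _ _))

  -- Induction on `j`: contraction takes side `t ^ suc j` to side `t ^ j`, and a minor of the
  -- contraction lifts back.
  ones≤density : ∀ j M → Minor (Support M) k k ⊎ ones (t ^ j) (t ^ j) M ≤ density * t ^ j
  ones≤density zero M = inj₂ (≤-trans (⟦⟧≤1 (M 0 0)) (*-mono-≤ density≥1 (≤-refl {1})))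
  ones≤density (suc j) M
    with wide-bound (t ^ j) M | tall-bound (t ^ j) M | ones≤density j (contract t M)
  ... | inj₁ m | _ | _ = inj₁ m
  ... | inj₂ _ | inj₁ m | _ = inj₁ m
  ... | inj₂ _ | inj₂ _ | inj₁ m = inj₁ (contractRows-minor t (contractCols-minor t m))
  ... | inj₂ w | inj₂ h | inj₂ c = inj₂ (begin
    ones (t * n) (t * n) M ≡⟨ cong (λ m → ones m m M) (*-comm t n) ⟩
    ones (n * t) (n * t) M ≤⟨ ones-bound t M s n ⟩
    t * t * ones n n (wide t M s) + t * t * ones n n (tall t M s) + s * s * ones n n (contract t M)
      ≤⟨ +-mono-≤ (+-mono-≤ (*-monoʳ-≤ (t * t) w) (*-monoʳ-≤ (t * t) h)) (*-monoʳ-≤ (s * s) c) ⟩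
    t * t * (n * F) + t * t * (n * F) + s * s * (density * n)
      ≡⟨ collect t n F (s * s) ⟩
    -- Since `1 ≤ s * s`, the factor is at most `2 s² = t`, so the induction closes with the same
    -- `density`.
    (1 + s * s) * (density * n)
      ≤⟨ *-monoˡ-≤ (density * n) (+-monoˡ-≤ (s * s) (*-mono-≤ (m^n>0 2 l) (m^n>0 2 l))) ⟩
    (s * s + s * s) * (density * n) ≡⟨ cong (_* (density * n)) (sym t≡2s²) ⟩
    t * (density * n)               ≡⟨ rearrange t density n ⟩
    density * (t * n)               ∎)
    where
    open ≤-Reasoning
    n F : ℕ
    n = t ^ j
    F = k * 4 ^ a
    collect : ∀ t n F q → t * t * (n * F) + t * t * (n * F) + q * (2 * (F * (t * t)) * n) ≡
                          (1 + q) * (2 * (F * (t * t)) * n)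
    collect = solve-∀
    rearrange : ∀ t d n → t * (d * n) ≡ d * (t * n)
    rearrange = solve-∀

-- One-sided greedy

Between : ℕ → ℕ → ℕ → Set
Between x a b = a ⊓ b ≤ x × x ≤ a ⊔ b

maxTime-∈ : ∀ ys {m} → maxTime ys ≡ just m → m ∈ ys
maxTime-∈ (y ∷ ys) eq with maxTime ys in eq′
maxTime-∈ (y ∷ ys) refl | nothing = here refl
maxTime-∈ (y ∷ ys) refl | just m with ℤ.⊔-sel y m
... | inj₁ ≡y = here ≡y
... | inj₂ ≡m = there (subst (_∈ ys) (sym ≡m) (maxTime-∈ ys eq′))

tau-∈ : ∀ P b {s} → tau P b ≡ just s → (b , s) ∈ P
tau-∈ P b eq with ∈-map⁻ proj₂ (maxTime-∈ (map proj₂ (filter (λ p → proj₁ p ≟ b) P)) eq)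
... | _ , p∈ , refl with ∈-filter⁻ (λ p → proj₁ p ≟ b) {xs = P} p∈
... | p∈P , refl = p∈P

and-map⁻ : ∀ {A : Set} (f : A → Bool) {xs x} → and (map f xs) ≡ true → x ∈ xs → f x ≡ true
and-map⁻ f eq (here refl) = proj₁ (∧-true⁻ eq)
and-map⁻ f {y ∷ _} eq (there x∈) = and-map⁻ f (proj₂ (∧-true⁻ {f y} eq)) x∈

inBox⁺ : ∀ {a t b s x y} → Between x a b → s ℤ.≤ y → y ℤ.≤ t → inBox a t b s (x , y) ≡ true
inBox⁺ {t = t} {s = s} {y = y} (lo , hi) s≤y y≤t rewrite ≤ᵇ-true⁺ lo | ≤ᵇ-true⁺ hi
  with s ℤ.≤ᵇ y | ℤ.≤⇒≤ᵇ s≤y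
... | true | _ with y ℤ.≤ᵇ t | ℤ.≤⇒≤ᵇ y≤t
... | true | _ = refl

-- At time `s` or later the point would lie in the rectangle, and `b ≢ c` makes it different from
-- the corner.
boxEmpty⇒later : ∀ {P a t c s b y} → boxEmpty P a t c s ≡ true → (b , y) ∈ P →
                 Between b a c → b ≢ c → y ℤ.≤ t → y ℤ.< s
boxEmpty⇒later {P} {a} {t} {c} {s} {b} {y} empty p∈P between b≢c y≤t with s ℤ.≤? y
... | no  s≰y = ℤ.≰⇒> s≰y
... | yes s≤y with and-map⁻ (λ p → not (inBox a t c s p) ∨ ⌊ p ≟P (c , s) ⌋) empty p∈P
... | free rewrite inBox⁺ {a} {t} {c} between s≤y y≤t with (b , y) ≟P (c , s)
... | yes eq = contradiction (cong proj₁ eq) b≢c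
... | no _ with () ← free

inStair⇒box : ∀ P a t b → inStair P a t b ≡ true → ∃[ s ] ((b , s) ∈ P × boxEmpty P a t b s ≡ true)
inStair⇒box P a t b eq with tau P b in τ
... | just s = s , tau-∈ P b τ , proj₂ (∧-true⁻ {not ⌊ b ≟ a ⌋} eq)

stair⁻ : ∀ side P a t {b} → b ∈ stair side P a t →
         b ∈ map proj₁ P × side b a ≡ true × inStair P a t b ≡ true
stair⁻ side P a t {b} b∈ with ∈-filter⁻ _ {xs = columns P} b∈
... | b∈cols , Tb = ∈-deduplicate⁻ _≟_ (map proj₁ P) b∈cols , ∧-true⁻ (Equivalence.to T-≡ Tb)

-- The clock advances by `t + 1`, so that `+ (t + 1)` agrees definitionally with the time in
-- `runGreedy`.
accesses : ℕ → List ℕ → List (ℕ × ℕ)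
accesses t []       = []
accesses t (a ∷ xs) = (a , t) ∷ accesses (t + 1) xs

-- "side c b" says that c lies beyond b when looking in the direction of the side.
OneSided : Side → Set
OneSided side = ∀ {a b c} → side c b ≡ true → side c a ≡ true → Between a b c ⊎ (Between b a c × b ≢ c)

-- `1 ≤ t` restricts attention to output points, since the initial tree lies at times below 1; `A`
-- lists the accesses served so far.
Revealing : Side → List Point → List (ℕ × ℕ) → Set
Revealing side P A = ∀ {b t c s} → 1 ≤ t → t < s → side c b ≡ true → (b , + t) ∈ P → (c , + s) ∈ P →
  ∃[ a ] ∃[ r ] ((a , r) ∈ A × t ≤ r × r ≤ s × Between a b c)

Before : ℕ → List Point → Set
Before t P = ∀ {p} → p ∈ P → proj₂ p ℤ.< + t

-- Definitionally the local `new` of `runGreedy`.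
touched : Side → List Point → ℕ → ℤ → List Point
touched side P a t = (a , t) ∷ map (λ b → (b , t)) (stair side P a t)

touched⁻ : ∀ side P a t {p} → p ∈ touched side P a t →
           proj₂ p ≡ t × (proj₁ p ≡ a ⊎ proj₁ p ∈ stair side P a t)
touched⁻ side P a t (here refl) = refl , inj₁ refl
touched⁻ side P a t (there p∈) with _ , b∈ , refl ← ∈-map⁻ _ p∈ = refl , inj₂ b∈

module _ {side : Side} (oneSided : OneSided side) where

  -- If b lies between the access a and the touched key c, then c was last touched
  -- strictly after b, so the claim for (c , s) follows from an earlier touch of c.
  revealing-step : ∀ {P A a t} → Before t P → Revealing side P A →
                   Revealing side (touched side P a (+ t) ++ P) ((a , t) ∷ A)
  revealing-step {P} {A} {a} {t} before rev {b} {tb} {c} {tc} 1≤tb tb<tc c>b p∈ q∈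
    with ∈-++⁻ (touched side P a (+ t)) p∈ | ∈-++⁻ (touched side P a (+ t)) q∈
  ... | inj₁ p∈new | inj₁ q∈new 
    with refl , _ ← touched⁻ side P a (+ t) p∈new | refl , _ ← touched⁻ side P a (+ t) q∈new =
    contradiction tb<tc (<-irrefl refl)
  ... | inj₁ p∈new | inj₂ q∈P with refl , _ ← touched⁻ side P a (+ t) p∈new =
    contradiction tb<tc (<⇒≯ (ℤ.drop‿+<+ (before q∈P)))
  ... | inj₂ p∈P | inj₂ q∈P =
    let a′ , r , ar∈ , rest = rev 1≤tb tb<tc c>b p∈P q∈P in a′ , r , there ar∈ , rest
  ... | inj₂ p∈P | inj₁ q∈new with touched⁻ side P a (+ t) q∈new
  ... | refl , inj₁ refl = a , t , here refl , <⇒≤ tb<tc , ≤-refl , m⊓n≤n b a , m≤n⊔m b a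
  ... | refl , inj₂ c∈ with stair⁻ side P a (+ t) c∈
  ... | _ , c>a , inS with oneSided {a} {b} {c} c>b c>a
  ... | inj₁ a-between = a , t , here refl , <⇒≤ tb<tc , ≤-refl , a-between
  ... | inj₂ (b-between , b≢c) with inStair⇒box P a (+ t) c inS
  ... | s , cs∈P , empty with s | boxEmpty⇒later {P} {a} empty p∈P b-between b≢c (+≤+ (<⇒≤ tb<tc))
  -- The earlier touch of `c` comes strictly after `tb`, hence at a natural-number time, and `rev`
  -- applies to it.
  ... | + r | +<+ tb<r =
    let a′ , r′ , ar∈ , tb≤r′ , r′≤r , between = rev 1≤tb tb<r c>b p∈P cs∈P
    in a′ , r′ , there ar∈ , tb≤r′ , ≤-trans r′≤r (<⇒≤ (ℤ.drop‿+<+ (before cs∈P))) , between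

  before-step : ∀ {P a t} → Before t P → Before (t + 1) (touched side P a (+ t) ++ P)
  before-step {P} {a} {t} before p∈ with ∈-++⁻ (touched side P a (+ t)) p∈
  ... | inj₁ p∈new rewrite proj₁ (touched⁻ side P a (+ t) p∈new) = +<+ (m<m+n t z<s)
  ... | inj₂ p∈P = ℤ.<-≤-trans (before p∈P) (+≤+ (m≤m+n t 1))

  revealing-run : ∀ {P A t} xs → Before t P → Revealing side P A →
                  Revealing side (runGreedy side P (+ t) xs ++ P) (accesses t xs ++ A)
  revealing-run []       before rev = rev
  revealing-run {P} {A} {t} (a ∷ xs) before rev 1≤tb tb<tc c>b p∈ q∈ =
    let a′ , r , ar∈ , rest =
          revealing-run xs (before-step {a = a} before) (revealing-step {a = a} before rev)
                        1≤tb tb<tc c>b (regroup p∈) (regroup q∈)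
    in a′ , r , swap (∈-++⁻ (accesses (t + 1) xs) ar∈) , rest
    where
    new later : List Point
    new   = touched side P a (+ t)
    later = runGreedy side (new ++ P) (+ (t + 1)) xs
    regroup : ∀ {p} → p ∈ (new ++ later) ++ P → p ∈ later ++ (new ++ P)
    regroup p∈ with ∈-++⁻ (new ++ later) p∈
    ... | inj₂ p∈P = ∈-++⁺ʳ later (∈-++⁺ʳ new p∈P)
    ... | inj₁ p∈ with ∈-++⁻ new p∈
    ... | inj₁ p∈new   = ∈-++⁺ʳ later (∈-++⁺ˡ p∈new)
    ... | inj₂ p∈later = ∈-++⁺ˡ p∈later
    swap : ∀ {z} → z ∈ accesses (t + 1) xs ⊎ z ∈ (a , t) ∷ A → z ∈ accesses t (a ∷ xs) ++ A
    swap (inj₁ z∈)          = there (∈-++⁺ˡ z∈)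
    swap (inj₂ (here z≡))   = here z≡
    swap (inj₂ (there z∈A)) = there (∈-++⁺ʳ (accesses (t + 1) xs) z∈A)

touched-keys≤ : ∀ side {P n} a t → a ≤ n → All ((_≤ n) ∘ proj₁) P →
                ∀ {p} → p ∈ touched side P a t → proj₁ p ≤ n
touched-keys≤ side {P} a t a≤n P≤n p∈ with touched⁻ side P a t p∈
... | _ , inj₁ refl = a≤n
... | _ , inj₂ b∈ with q , q∈P , refl ← ∈-map⁻ proj₁ (proj₁ (stair⁻ side P a t b∈)) = All.lookup P≤n q∈P

-- Only the accessed key and columns already present are touched, and each access fills one row; the
-- output therefore fits in a finite grid.
runGreedy-range : ∀ side {P n} t xs → All (_≤ n) xs → All ((_≤ n) ∘ proj₁) P →
  ∀ {p} → p ∈ runGreedy side P (+ t) xs →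
  ∃[ x ] ∃[ y ] (p ≡ (x , + y) × x ≤ n × t ≤ y × y < t + length xs)
runGreedy-range side {P} {n} t (a ∷ xs) (a≤n ∷ xs≤n) P≤n {p} p∈
  with ∈-++⁻ (touched side P a (+ t)) p∈
... | inj₁ p∈new = proj₁ p , t , cong (proj₁ p ,_) (proj₁ (touched⁻ side P a (+ t) p∈new))
                 , touched-keys≤ side a (+ t) a≤n P≤n p∈new , ≤-refl , m<m+n t z<s
... | inj₂ p∈later with runGreedy-range side (t + 1) xs xs≤n
    (++⁺ (All.tabulate (touched-keys≤ side a (+ t) a≤n P≤n)) P≤n) p∈later
... | x , y , refl , x≤n , t+1≤y , y< =
  x , y , refl , x≤n , ≤-trans (m≤m+n t 1) t+1≤y , subst (y <_) (+-assoc t 1 (length xs)) y<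

-- Initial trees

keysWithDepth-∈inorder : ∀ T {i x d} → (x , d) ∈ keysWithDepth i T → x ∈ inorder T
keysWithDepth-∈inorder (node l y r) (here refl) = ∈-++⁺ʳ (inorder l) (here refl)
keysWithDepth-∈inorder (node l y r) {i} (there p∈) with ∈-++⁻ (keysWithDepth (suc i) l) p∈
... | inj₁ p∈l = ∈-++⁺ˡ (keysWithDepth-∈inorder l p∈l)
... | inj₂ p∈r = ∈-++⁺ʳ (inorder l) (there (keysWithDepth-∈inorder r p∈r))

keysWithDepth-depth : ∀ T {i x d} → (x , d) ∈ keysWithDepth i T → i ≤ d × 1 ≤ height T
keysWithDepth-depth (node l y r) (here refl) = ≤-refl , s≤s z≤n
keysWithDepth-depth (node l y r) {i} (there p∈) with ∈-++⁻ (keysWithDepth (suc i) l) p∈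
... | inj₁ p∈l = ≤-trans (n≤1+n i) (proj₁ (keysWithDepth-depth l p∈l)) , s≤s z≤n
... | inj₂ p∈r = ≤-trans (n≤1+n i) (proj₁ (keysWithDepth-depth r p∈r)) , s≤s z≤n

treePoints⁻ : ∀ T {p} → p ∈ treePoints T → proj₁ p ∈ inorder T × proj₂ p ℤ.< + 1
treePoints⁻ T p∈ with find (∈-concatMap⁻ _ {xs = keysWithDepth 1 T} p∈)
... | (x , d) , k∈ , p∈col with ∈-map⁻ _ p∈col
... | i , i∈ , refl with keysWithDepth-depth T k∈
... | 1≤d , 1≤h = keysWithDepth-∈inorder T k∈ , (begin-strict
  (+ 1) ℤ.- (+ h) ℤ.+ (+ i) <⟨ ℤ.+-monoʳ-< ((+ 1) ℤ.- (+ h)) (+<+ i<h) ⟩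
  (+ 1) ℤ.- (+ h) ℤ.+ (+ h) ≡⟨ ℤ.+-assoc (+ 1) (ℤ.- (+ h)) (+ h) ⟩
  (+ 1) ℤ.+ (ℤ.- (+ h) ℤ.+ (+ h)) ≡⟨ cong (ℤ._+_ (+ 1)) (ℤ.+-inverseˡ (+ h)) ⟩
  + 1 ∎)
  where
  open ℤ.≤-Reasoning
  h = height T
  i<h : i < h
  -- The index is at most `h ∸ d ≤ h ∸ 1`, as depths start at 1; `1 ≤ h` keeps the truncated
  -- subtraction exact.
  i<h = <-≤-trans (∈-upTo⁻ i∈) (subst (suc (h ∸ d) ≤_) (m+[n∸m]≡n 1≤h) (s≤s (∸-monoʳ-≤ h 1≤d)))

range-≤ : ∀ {n x} → x ∈ range n → x ≤ n
range-≤ x∈ with _ , i∈ , refl ← ∈-map⁻ suc x∈ = ∈-upTo⁻ i∈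

initPoints-keys≤ : ∀ {n} T → ValidInit n T → All ((_≤ n) ∘ proj₁) (initPoints T)
initPoints-keys≤ nothing  _   = []
initPoints-keys≤ (just T) bst =
  All.tabulate λ p∈ → range-≤ (subst (_ ∈_) bst (proj₁ (treePoints⁻ T p∈)))

initPoints-before : ∀ T → Before 1 (initPoints T)
initPoints-before nothing  ()
initPoints-before (just T) p∈ = proj₂ (treePoints⁻ T p∈)

-- Patterns among the accesses

accesses-≥ : ∀ t xs {p} → p ∈ accesses t xs → t ≤ proj₂ p
accesses-≥ t (a ∷ xs) (here refl) = ≤-refl
accesses-≥ t (a ∷ xs) (there p∈)  = ≤-trans (m≤m+n t 1) (accesses-≥ (t + 1) xs p∈)

accesses-tail : ∀ {t a xs zs} → All (λ z → t < proj₂ z) zs →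
                All (_∈ accesses t (a ∷ xs)) zs → All (_∈ accesses (t + 1) xs) zs
accesses-tail []         []               = []
accesses-tail (t< ∷ t<s) (here refl ∷ _)  = contradiction t< (<-irrefl refl)
accesses-tail (t< ∷ t<s) (there z∈ ∷ zs∈) = z∈ ∷ accesses-tail t<s zs∈

-- Times are positions in the access sequence, so accesses in order of time can be read off it from
-- left to right.
accesses-sublist : ∀ t xs zs → AllPairs (λ z z′ → proj₂ z < proj₂ z′) zs →
                   All (_∈ accesses t xs) zs → map proj₁ zs ⊆ xs
accesses-sublist t xs       []       _            _                 = minimum xs
accesses-sublist t []       (z ∷ zs) _            (() ∷ _)
accesses-sublist t (a ∷ xs) (z ∷ zs) (z< ∷ zs<)   (here refl ∷ zs∈) =
  refl ∷ accesses-sublist (t + 1) xs zs zs< (accesses-tail z< zs∈)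
accesses-sublist t (a ∷ xs) (z ∷ zs) (z< ∷ zs<)   (there z∈ ∷ zs∈)  =
  a ∷ʳ accesses-sublist (t + 1) xs (z ∷ zs) (z< ∷ zs<)
         (z∈ ∷ accesses-tail (All.map (<-trans t<z) z<) zs∈)
  where
  t<z : t < proj₂ z
  t<z = <-≤-trans (m<m+n t z<s) (accesses-≥ (t + 1) xs z∈)

lookup-tabulate-cast : ∀ {A : Set} {n} (f : Fin n → A) .(eq : length (tabulate f) ≡ n) i →
                       lookup (tabulate f) i ≡ f (cast eq i)
lookup-tabulate-cast {n = suc n} f eq zero    = refl
lookup-tabulate-cast {n = suc n} f eq (suc i) = lookup-tabulate-cast (f ∘ suc) (cong pred eq) i

Unique-lookup-injective : ∀ {A : Set} {xs : List A} → Unique xs →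
                          ∀ i j → lookup xs i ≡ lookup xs j → i ≡ j
Unique-lookup-injective (x∉ ∷ u) zero    zero    _  = refl
Unique-lookup-injective (x∉ ∷ u) zero    (suc j) eq = contradiction eq (All.lookup x∉ (∈-lookup j))
Unique-lookup-injective (x∉ ∷ u) (suc i) zero    eq = contradiction (sym eq) (All.lookup x∉ (∈-lookup i))
Unique-lookup-injective (x∉ ∷ u) (suc i) (suc j) eq = cong suc (Unique-lookup-injective u i j eq)

-- One direction of the key comparison suffices: the entries of `π` are distinct, so trichotomy
-- gives the converse.
contains⁺ : ∀ {X π} → Unique π → (f : Fin (length π) → ℕ × ℕ) →
            (∀ i → f i ∈ accesses 1 X) →
            (∀ {i j} → i Fin.< j → proj₂ (f i) < proj₂ (f j)) →
            (∀ {i j} → lookup π i < lookup π j → proj₁ (f i) < proj₁ (f j)) →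
            Contains X π
contains⁺ {X} {π} unique f f∈ times keys =
  tabulate (proj₁ ∘ f) ,
  subst (_⊆ X) (map-tabulate f proj₁)
    (accesses-sublist 1 X (tabulate f) (AllPairs.tabulate⁺-< times) (All.tabulate⁺ f∈)) ,
  length-tabulate (proj₁ ∘ f) , λ i j →
    (λ lt → reflect (subst₂ _<_ (at i) (at j) lt)) ,
    (λ lt → subst₂ _<_ (sym (at i)) (sym (at j)) (keys lt))
  where
  at = lookup-tabulate-cast (proj₁ ∘ f) (length-tabulate (proj₁ ∘ f))
  reflect : ∀ {i j} → proj₁ (f i) < proj₁ (f j) → lookup π i < lookup π j
  reflect {i} {j} lt with <-cmp (lookup π i) (lookup π j)
  ... | tri< vi<vj _ _ = vi<vj
  ... | tri≈ _ vi≡vj _ with refl ← Unique-lookup-injective unique i j vi≡vj = contradiction lt (<-irrefl refl)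
  ... | tri> _ _ vi>vj = contradiction lt (<⇒≯ (keys vi>vj))

-- From minors of the output to pattern occurrences.

label-< : ∀ {lab : ℕ → ℕ} → (∀ {x x′} → x ≤ x′ → lab x ≤ lab x′) →
          ∀ {x x′} → lab x < lab x′ → x < x′
label-< mono lt = ≰⇒> λ x′≤x → <⇒≱ lt (mono x′≤x)

-- Separates the pair of labels reserved for `m` from the pair reserved for `n`.
m+m-gap : ∀ {m n} → m < n → suc (m + m) < n + n
m+m-gap {m} {n} m<n = subst (_≤ n + n) (cong suc (+-suc m m)) (+-mono-≤ m<n m<n)

-- The column labels, among v + v and suc (v + v), of the two touched keys that
-- replace a value v of the pattern.
record Orientation (side : Side) : Set where
  field
    oneSided       : OneSided side
    near far       : ℕ → ℕ
    near-≥         : ∀ v → v + v ≤ near v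
    near-≤         : ∀ v → near v ≤ suc (v + v)
    far-≥          : ∀ v → v + v ≤ far v
    far-≤          : ∀ v → far v ≤ suc (v + v)
    beyond         : ∀ {b c} v → (near v < far v → b < c) → (far v < near v → c < b) → side c b ≡ true

<ᵇ-true⁻ : ∀ m n → (m <ᵇ n) ≡ true → m < n
<ᵇ-true⁻ m n = ≤ᵇ-true⁻ (suc m) n

<ᵇ-true⁺ : ∀ {m n} → m < n → (m <ᵇ n) ≡ true
<ᵇ-true⁺ = ≤ᵇ-true⁺

right-orientation : Orientation rightSide
right-orientation = record
  { oneSided = λ {a} {b} {c} → one a b c
  ; near     = λ v → v + v
  ; far      = λ v → suc (v + v)
  ; near-≥   = λ _ → ≤-refl
  ; near-≤   = λ v → n≤1+n (v + v)
  ; far-≥    = λ v → n≤1+n (v + v)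
  ; far-≤    = λ _ → ≤-refl
  ; beyond   = λ v b<c _ → <ᵇ-true⁺ (b<c ≤-refl)
  }
  where
  one : ∀ a b c → rightSide c b ≡ true → rightSide c a ≡ true → Between a b c ⊎ (Between b a c × b ≢ c)
  one a b c b<c a<c with b ≤? a
  ... | yes b≤a = inj₁ (≤-trans (m⊓n≤m b c) b≤a , ≤-trans (<⇒≤ (<ᵇ-true⁻ a c a<c)) (m≤n⊔m b c))
  ... | no  b≰a = inj₂ ((≤-trans (m⊓n≤m a c) (<⇒≤ (≰⇒> b≰a)) , ≤-trans (<⇒≤ (<ᵇ-true⁻ b c b<c)) (m≤n⊔m a c))
                       , <⇒≢ (<ᵇ-true⁻ b c b<c))

left-orientation : Orientation leftSide
left-orientation = record
  { oneSided = λ {a} {b} {c} → one a b c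
  ; near     = λ v → suc (v + v)
  ; far      = λ v → v + v
  ; near-≥   = λ v → n≤1+n (v + v)
  ; near-≤   = λ _ → ≤-refl
  ; far-≥    = λ _ → ≤-refl
  ; far-≤    = λ v → n≤1+n (v + v)
  ; beyond   = λ v _ c<b → <ᵇ-true⁺ (c<b ≤-refl)
  }
  where
  one : ∀ a b c → leftSide c b ≡ true → leftSide c a ≡ true → Between a b c ⊎ (Between b a c × b ≢ c)
  one a b c c<b c<a with a ≤? b
  ... | yes a≤b = inj₁ (≤-trans (m⊓n≤n b c) (<⇒≤ (<ᵇ-true⁻ c a c<a)) , ≤-trans a≤b (m≤m⊔n b c))
  ... | no  a≰b = inj₂ ((≤-trans (m⊓n≤n a c) (<⇒≤ (<ᵇ-true⁻ c b c<b)) , ≤-trans (<⇒≤ (≰⇒> a≰b)) (m≤m⊔n a c))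
                       , ≢-sym (<⇒≢ (<ᵇ-true⁻ c b c<b)))

-- The minor contains the pattern in which every entry of π is replaced by two
-- entries in the direction of the side; each such pair reveals an access.
module _ {side : Side} (orientation : Orientation side)
         {P : List Point} {X : List ℕ} {k : ℕ} {π : List ℕ}
         (unique : Unique π) (π≤k : All (_≤ k) π) (|π|≤k : length π ≤ k)
         (positive : ∀ {x y} → (x , + y) ∈ P → 1 ≤ y)
         (revealing : Revealing side P (accesses 1 X))
         (minor : Minor (λ x y → (x , + y) ∈ P) (2+ (k + k)) (2+ (k + k)))
         where

  open Minor minor
  open Orientation orientation

  -- Values of `π` go up to `k` itself, so labels reach `suc (k + k)`; this sets the side of the
  -- minor.
  in-range : ∀ {m v} → v ≤ k → m ≤ suc (v + v) → m < 2+ (k + k)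
  in-range v≤k m≤ = s≤s (≤-trans m≤ (s≤s (+-mono-≤ v≤k v≤k)))

  -- The minor supplies a near touch in row interval `i + i` and a far touch in the next one. The
  -- access revealed between them stays within both pairs of labels by monotonicity.
  reveal : ∀ i v → i ≤ k → v ≤ k → ∃[ a ] ∃[ r ] ((a , r) ∈ accesses 1 X ×
           (i + i ≤ rowLabel r × rowLabel r ≤ suc (i + i)) ×
           (v + v ≤ colLabel a × colLabel a ≤ suc (v + v)))
  reveal i v i≤k v≤k =
    let b , t , b∈ , t∈ , p∈P = entry (in-range i≤k (n≤1+n (i + i))) (in-range v≤k (near-≤ v))
        c , s , c∈ , s∈ , q∈P = entry (in-range i≤k ≤-refl) (in-range v≤k (far-≤ v))
        t<s = label-< rowLabel-mono (subst₂ _<_ (sym t∈) (sym s∈) ≤-refl)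
        -- The order of labels forces the order of keys; the two implications cover both orders of
        -- `near v` and `far v`.
        c>b = beyond {b} {c} v (label-< colLabel-mono ∘ subst₂ _<_ (sym b∈) (sym c∈))
                       (label-< colLabel-mono ∘ subst₂ _<_ (sym c∈) (sym b∈))
        b≥ = subst (v + v ≤_) (sym b∈) (near-≥ v)
        c≥ = subst (v + v ≤_) (sym c∈) (far-≥ v)
        b≤ = subst (_≤ suc (v + v)) (sym b∈) (near-≤ v)
        c≤ = subst (_≤ suc (v + v)) (sym c∈) (far-≤ v)
        a , r , ar∈ , t≤r , r≤s , lo , hi = revealing (positive p∈P) t<s c>b p∈P q∈P
    in a , r , ar∈ ,
       (≤-trans (≤-reflexive (sym t∈)) (rowLabel-mono t≤r) ,
        ≤-trans (rowLabel-mono r≤s) (≤-reflexive s∈)) ,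
       (≤-trans (⊓-case b c b≥ c≥) (colLabel-mono lo) ,
        ≤-trans (colLabel-mono hi) (⊔-case b c b≤ c≤))
    where
    ⊓-case : ∀ b c → v + v ≤ colLabel b → v + v ≤ colLabel c → v + v ≤ colLabel (b ⊓ c)
    ⊓-case b c b≥ c≥ with ⊓-sel b c
    ... | inj₁ eq rewrite eq = b≥
    ... | inj₂ eq rewrite eq = c≥
    ⊔-case : ∀ b c → colLabel b ≤ suc (v + v) → colLabel c ≤ suc (v + v) → colLabel (b ⊔ c) ≤ suc (v + v)
    ⊔-case b c b≤ c≤ with ⊔-sel b c
    ... | inj₁ eq rewrite eq = b≤
    ... | inj₂ eq rewrite eq = c≤

  minor⇒contains : Contains X π
  minor⇒contains = contains⁺ unique (λ i → proj₁ (pick i) , proj₁ (proj₂ (pick i)))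
    (λ i → proj₁ (proj₂ (proj₂ (pick i))))
    (λ {i} {j} i<j → let _ , _ , _ , (_ , hi) , _ = pick i
                         _ , _ , _ , (lo , _) , _ = pick j
                     in label-< rowLabel-mono (≤-<-trans hi (<-≤-trans (m+m-gap i<j) lo)))
    (λ {i} {j} v<v′ → let _ , _ , _ , _ , (_ , hi) = pick i
                          _ , _ , _ , _ , (lo , _) = pick j
                      in label-< colLabel-mono (≤-<-trans hi (<-≤-trans (m+m-gap v<v′) lo)))
    where
    pick : ∀ i → _
    pick i = reveal (toℕ i) (lookup π i) (≤-trans (<⇒≤ (toℕ<n i)) |π|≤k) (All.lookup π≤k (∈-lookup i))

-- Counting the output

Unique-⊆-length : ∀ {A : Set} {xs ys : List A} → Unique xs → (∀ {x} → x ∈ xs → x ∈ ys) →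
                  length xs ≤ length ys
Unique-⊆-length []               xs⊆ys = z≤n
Unique-⊆-length {xs = x ∷ xs} (x∉xs ∷ unique) xs⊆ys
  with hs , ts , refl ← ∈-∃++ (xs⊆ys (here refl)) = begin
    suc (length xs)              ≤⟨ s≤s (Unique-⊆-length unique rest) ⟩
    suc (length (hs ++ ts))      ≡⟨ cong suc (length-++ hs) ⟩
    suc (length hs + length ts)  ≡⟨ +-suc (length hs) (length ts) ⟨
    length hs + suc (length ts)  ≡⟨ length-++ hs ⟨
    length (hs ++ x ∷ ts)        ∎
  where
  open ≤-Reasoning
  rest : ∀ {z} → z ∈ xs → z ∈ hs ++ ts
  rest z∈xs with ∈-++⁻ hs (xs⊆ys (there z∈xs))
  ... | inj₁ z∈hs         = ∈-++⁺ˡ z∈hs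
  ... | inj₂ (here refl)  = contradiction refl (All.lookup x∉xs z∈xs)
  ... | inj₂ (there z∈ts) = ∈-++⁺ʳ hs z∈ts

columnPoints : ℕ → ℕ → (ℕ → Bool) → List Point
columnPoints x zero    p = []
columnPoints x (suc n) p = columnPoints x n p ++ (if p n then (x , + n) ∷ [] else [])

length-columnPoints : ∀ x n p → length (columnPoints x n p) ≡ count n p
length-columnPoints x zero    p = refl
length-columnPoints x (suc n) p
  rewrite length-++ (columnPoints x n p) {if p n then (x , + n) ∷ [] else []}
        | length-columnPoints x n p with p n
... | true  = refl
... | false = refl

∈-columnPoints : ∀ x n p {y} → y < n → p y ≡ true → (x , + y) ∈ columnPoints x n p
∈-columnPoints x (suc n) p {y} y<1+n py with y ≟ n
... | yes refl rewrite py = ∈-++⁺ʳ (columnPoints x n p) (here refl)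
... | no  y≢n  = ∈-++⁺ˡ (∈-columnPoints x n p (≤∧≢⇒< (s≤s⁻¹ y<1+n) y≢n) py)

-- Enumerates the ones as points, so that the length of a duplicate-free output list can be compared
-- with `ones`.
matrixPoints : ℕ → ℕ → Matrix → List Point
matrixPoints zero    n M = []
matrixPoints (suc m) n M = matrixPoints m n M ++ columnPoints m n (M m)

length-matrixPoints : ∀ m n M → length (matrixPoints m n M) ≡ ones m n M
length-matrixPoints zero    n M = refl
length-matrixPoints (suc m) n M = trans (length-++ (matrixPoints m n M))
  (cong₂ _+_ (length-matrixPoints m n M) (length-columnPoints m n (M m)))

∈-matrixPoints : ∀ m n M {x y} → x < m → y < n → M x y ≡ true → (x , + y) ∈ matrixPoints m n M
∈-matrixPoints (suc m) n M {x} x<1+m y<n Mxy with x ≟ m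
... | yes refl = ∈-++⁺ʳ (matrixPoints m n M) (∈-columnPoints m n (M m) y<n Mxy)
... | no  x≢m  = ∈-++⁺ˡ (∈-matrixPoints m n M (≤∧≢⇒< (s≤s⁻¹ x<1+m) x≢m) y<n Mxy)

outputMatrix : List Point → Matrix
outputMatrix P x y = does ((x , + y) ∈? P)

outputMatrix⁻ : ∀ P {x y} → outputMatrix P x y ≡ true → (x , + y) ∈ P
outputMatrix⁻ P {x} {y} eq with (x , + y) ∈? P
... | yes p∈ = p∈

outputMatrix⁺ : ∀ P {x y} → (x , + y) ∈ P → outputMatrix P x y ≡ true
outputMatrix⁺ P {x} {y} = dec-true ((x , + y) ∈? P)

-- Assembling the bound

m≤2^m : ∀ m → m ≤ 2 ^ m
m≤2^m zero    = z≤n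
m≤2^m (suc m) = +-mono-≤ (m^n>0 2 m) (≤-trans (m≤2^m m) (m≤m+n (2 ^ m) 0))

-- The matrix bound holds for sides `t ^ j` only; rounding up to such a side costs a factor of at
-- most `t`.
power-between : ∀ t → 2 ≤ t → ∀ n → ∃[ j ] (suc n < t ^ j × t ^ j ≤ suc n * t)
power-between t 2≤t zero = 1 , subst (2 ≤_) (sym (*-identityʳ t)) 2≤t
                             , ≤-reflexive (*-comm t 1)
power-between t 2≤t (suc n) with power-between t 2≤t n
... | j , lo , hi with 2+ n <? t ^ j
... | yes lt = j , lt , ≤-trans hi (m≤n+m (suc n * t) t)
... | no  ≮  = suc j , <-≤-trans (m<m+n (2+ n) z<s) (*-mono-≤ 2≤t lo)
                     , ≤-trans (*-monoʳ-≤ t (≮⇒≥ ≮)) (≤-reflexive (*-comm t (2+ n)))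

range-unique : ∀ n → Unique (range n)
range-unique n = Unique.map⁺ suc-injective (Unique.upTo⁺ n)

length-range : ∀ n → length (range n) ≡ n
length-range n = trans (length-map suc (upTo n)) (length-upTo n)

module _ {n k : ℕ} {X : List ℕ} (T : Maybe Tree) (X↭ : X ↭ range n) (valid : ValidInit n T)
         {π : List ℕ} (π↭ : π ↭ range k) (avoids : Avoids X π) where

  -- With this argument the minor in `ones≤density` has side `2+ (k + k)`.
  open Fox (suc (k + k)) using (t; density; ones≤density)

  X≤n : All (_≤ n) X
  X≤n = All.tabulate (range-≤ ∘ ∈-resp-↭ X↭)

  output : Side → List Point
  output side = runGreedy side (initPoints T) (+ 1) X

  output-range : ∀ side {p} → p ∈ output side →
                 ∃[ x ] ∃[ y ] (p ≡ (x , + y) × x ≤ n × 1 ≤ y × y ≤ n)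
  output-range side p∈ with runGreedy-range side 1 X X≤n (initPoints-keys≤ T valid) p∈
  ... | x , y , refl , x≤n , 1≤y , s≤s y≤ =
    x , y , refl , x≤n , 1≤y , subst (y ≤_) (trans (↭-length X↭) (length-range n)) y≤

  output-revealing : ∀ {side} → Orientation side → Revealing side (output side) (accesses 1 X)
  output-revealing {side} o 1≤t t<s c>b p∈ q∈ =
    let a , r , ar∈ , rest = revealing-run (Orientation.oneSided o) {A = []} X (initPoints-before T) early
                               1≤t t<s c>b (∈-++⁺ˡ p∈) (∈-++⁺ˡ q∈)
    in a , r , subst ((a , r) ∈_) (++-identityʳ (accesses 1 X)) ar∈ , rest
    where
    early : Revealing side (initPoints T) []
    -- Vacuous: no point of the initial tree has time 1 or later.
    early 1≤t _ _ p∈ _ = contradiction (ℤ.drop‿+<+ (initPoints-before T p∈)) (≤⇒≯ 1≤t)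

  output-ones : ∀ {side} → Orientation side → ∀ j →
                ones (t ^ j) (t ^ j) (outputMatrix (output side)) ≤ density * t ^ j
  output-ones {side} o j with ones≤density j (outputMatrix (output side))
  ... | inj₂ le = le
  ... | inj₁ m  = contradiction
    (minor⇒contains o
      (Unique-resp-↭ (↭⇒↭ₛ (↭-sym π↭)) (range-unique k))
      (All.tabulate (range-≤ ∘ ∈-resp-↭ π↭))
      (≤-reflexive (trans (↭-length π↭) (length-range k)))
      (λ p∈ → positive (output-range side p∈))
      (output-revealing o)
      (minor-map (outputMatrix⁻ (output side)) m))
    avoids
    where
    positive : ∀ {x y} → ∃[ x′ ] ∃[ y′ ] (((x , + y) ≡ (x′ , + y′)) × x′ ≤ n × 1 ≤ y′ × y′ ≤ n) → 1 ≤ y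
    positive (_ , _ , refl , _ , 1≤y , _) = 1≤y

  -- The union is no larger than the two outputs together. Matrix indices start at 0 while keys and
  -- times reach `n`, hence the strict inequality.
  cost≤ones : ∀ N → n < N → sgreedyCost X T ≤
    ones N N (outputMatrix (output leftSide)) + ones N N (outputMatrix (output rightSide))
  cost≤ones N n<N = begin
    sgreedyCost X T ≤⟨ Unique-⊆-length (deduplicate-! _≟P_ both) covered ⟩
    length (matrixPoints N N L ++ matrixPoints N N R) ≡⟨ length-++ (matrixPoints N N L) ⟩
    length (matrixPoints N N L) + length (matrixPoints N N R)
      ≡⟨ cong₂ _+_ (length-matrixPoints N N L) (length-matrixPoints N N R) ⟩
    ones N N L + ones N N R ∎
    where
    open ≤-Reasoning
    both = output leftSide ++ output rightSide
    L = outputMatrix (output leftSide)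
    R = outputMatrix (output rightSide)
    cell : ∀ side {p} → p ∈ output side → p ∈ matrixPoints N N (outputMatrix (output side))
    cell side p∈ with output-range side p∈
    ... | x , y , refl , x≤n , _ , y≤n =
      ∈-matrixPoints N N _ (≤-<-trans x≤n n<N) (≤-<-trans y≤n n<N) (outputMatrix⁺ (output side) p∈)
    covered : ∀ {p} → p ∈ deduplicate _≟P_ both → p ∈ matrixPoints N N L ++ matrixPoints N N R
    covered p∈ with ∈-++⁻ (output leftSide) (∈-deduplicate⁻ _≟P_ both p∈)
    ... | inj₁ p∈L = ∈-++⁺ˡ (cell leftSide p∈L)
    ... | inj₂ p∈R = ∈-++⁺ʳ (matrixPoints N N L) (cell rightSide p∈R)

  cost≤powers : ∀ j → n < t ^ j → sgreedyCost X T ≤ density * t ^ j + density * t ^ j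
  cost≤powers j n<t^j = ≤-trans (cost≤ones (t ^ j) n<t^j)
    (+-mono-≤ (output-ones left-orientation j) (output-ones right-orientation j))

-- Here `K = 2k + 2`, `a = 4k + 3` and `t = 2 ^ a`. The left side equals `4 n K t ^ 5`, and
-- `K ≤ 2 ^ K` gives the exponent `2 + K + 5a = 22k + 19`, at most `41k` as `1 ≤ k`.
density-bound : ∀ n k → 1 ≤ k → let open Fox (suc (k + k)) using (t; density) in
  density * (n * t) + density * (n * t) ≤ n * 2 ^ (41 * k)
density-bound n k 1≤k = begin
  2 * (K * 4 ^ a * (t * t)) * (n * t) + 2 * (K * 4 ^ a * (t * t)) * (n * t)
    ≡⟨ cong (λ f → 2 * (K * f * (t * t)) * (n * t) + 2 * (K * f * (t * t)) * (n * t)) 4^a≡t² ⟩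
  2 * (K * (t * t) * (t * t)) * (n * t) + 2 * (K * (t * t) * (t * t)) * (n * t)
    ≡⟨ collect n K t ⟩
  n * (4 * (K * t ^ 5))           ≤⟨ *-monoʳ-≤ n (*-monoʳ-≤ 4 (*-monoˡ-≤ (t ^ 5) (m≤2^m K))) ⟩
  n * (2 ^ 2 * (2 ^ K * t ^ 5))   ≡⟨ cong (n *_) powers ⟩
  n * 2 ^ (2 + (K + a * 5))       ≤⟨ *-monoʳ-≤ n (^-monoʳ-≤ 2 exponent) ⟩
  n * 2 ^ (41 * k)                ∎
  where
  open ≤-Reasoning
  open Fox (suc (k + k)) using (a; t) renaming (k to K)
  4^a≡t² : 4 ^ a ≡ t * t
  4^a≡t² = trans (^-*-assoc 2 2 a) (trans (cong (2 ^_) (double a)) (^-distribˡ-+-* 2 a a))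
  collect : ∀ n K t → 2 * (K * (t * t) * (t * t)) * (n * t) + 2 * (K * (t * t) * (t * t)) * (n * t) ≡
                      n * (4 * (K * (t * (t * (t * (t * (t * 1)))))))
  collect = solve-∀
  powers : 2 ^ 2 * (2 ^ K * t ^ 5) ≡ 2 ^ (2 + (K + a * 5))
  powers = trans (cong (λ f → 2 ^ 2 * (2 ^ K * f)) (^-*-assoc 2 a 5))
          (trans (cong (2 ^ 2 *_) (sym (^-distribˡ-+-* 2 K (a * 5)))) (sym (^-distribˡ-+-* 2 2 (K + a * 5))))
  expand : ∀ k → 2 + (suc (suc (k + k)) + suc (suc (k + k) + suc (k + k)) * 5) ≡ 19 * 1 + 22 * k
  expand = solve-∀
  merge : ∀ k → 19 * k + 22 * k ≡ 41 * k
  merge = solve-∀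
  exponent : 2 + (K + a * 5) ≤ 41 * k
  exponent = ≤-trans (≤-reflexive (expand k))
    (≤-trans (+-monoˡ-≤ (22 * k) (*-monoʳ-≤ 19 1≤k)) (≤-reflexive (merge k)))

mainTheorem7 : ∃[ c ] ∀ (n k : ℕ) (X : List ℕ) (T : Maybe Tree) →
    X ↭ range n →
    (∃[ π ] (π ↭ range k × Avoids X π)) →
    ValidInit n T →
    sgreedyCost X T ≤ n * 2 ^ (c * k)
mainTheorem7 = 41 , λ where
  -- Without accesses there is no output.
  zero k X T X↭ _ _ → case ↭-empty-inv X↭ of λ { refl → z≤n }
  -- The empty pattern occurs in every sequence, so it cannot be avoided.
  (suc n) zero X T X↭ (π , π↭ , avoids) _ → case ↭-empty-inv π↭ of λ where
    refl → contradiction ([] , minimum X , refl , λ ()) avoids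
  (suc n) (suc k) X T X↭ (π , π↭ , avoids) valid →
    let open Fox (suc (suc k + suc k)) using (t; density; 2≤t)
        j , n<t^j , t^j≤nt = power-between t 2≤t n
        scaled = *-monoʳ-≤ density t^j≤nt
    in ≤-trans (cost≤powers T X↭ valid π↭ avoids j n<t^j)
         (≤-trans (+-mono-≤ scaled scaled) (density-bound (suc n) (suc k) (s≤s z≤n)))
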